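{- The search problem $\mathrm{Schrijver}(n,k,\lfloor n/2\rfloor-2k+1)$ is polynomial-time reducible to the search problem $\mathrm{Kneser}$ (both in the white-box input model).
   Context: Write $[n]=\{1,\ldots,n\}$, let $\binom{[n]}{k}$ be the family of all $k$-subsets of $[n]$. A subset of $[n]$ is stable if it contains no two consecutive elements and does not contain both $1$ and $n$. Let $\binom{[n]}{k}_{\mathrm{stab}}$ be the family of stable $k$-subsets of $[n]$. For positive integers $n\ge 2k$, the Kneser graph $K(n,k)$ has vertex set $\binom{[n]}{k}$, with two sets adjacent if and only if they are disjoint; the Schrijver graph $S(n,k)$ is its subgraph induced by $\binom{[n]}{k}_{\mathrm{stab}}$. Problem $\mathrm{Schrijver}(n,k,m)$, for a function $m=m(n,k)$: given positive integers $n,k$ with $n\ge 2k$ and a (not necessarily proper) coloring $c:\binom{[n]}{k}_{\mathrm{stab}}\to[m]$ with $m=m(n,k)$, find $A,B\in\binom{[n]}{k}_{\mathrm{stab}}$ with $A\cap B=\emptyset$ and $c(A)=c(B)$. Problem $\mathrm{Kneser}$: given positive integers $n,k$ with $n\ge 2k$ and a (not necessarily proper) coloring $c:\binom{[n]}{k}\to[n-2k+1]$, find $A,B\in\binom{[n]}{k}$ with $A\cap B=\emptyset$ and $c(A)=c(B)$. In the white-box input model, the coloring $c$ is given by a Boolean circuit that computes $c(A)$ from a vertex $A$. A search problem $P$ is polynomial-time reducible to a search problem $Q$ if there are polynomial-time computable maps, one taking each instance of $P$ to an instance of $Q$, and one taking each instance of $P$ together with any solution of the corresponding instance of $Q$ to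 a solution of the instance of $P$. -}

module Defs where

open import Data.Bool using (Bool; true; false; not; _∧_; _∨_; if_then_else_)
open import Data.Fin using (Fin; toℕ)
open import Data.Fin.Subset using (Subset; _∈_; _∩_; ∣_∣; Empty)
open import Data.Integer as ℤ using (ℤ; +_; 1ℤ)
open import Data.List as List using (List; []; _∷_; _++_; length; concatMap; replicate; drop; foldr)
open import Data.Maybe using (Maybe; just; nothing)
open import Data.Nat using (ℕ; suc; _+_; _*_; _^_; _≤_)
open import Data.Product using (Σ; ∃-syntax; _×_; _,_)
open import Data.Vec as Vec using (Vec; []; _∷_; lookup)
open import Relation.Binary.PropositionalEquality using (_≡_; _≢_)
open import Relation.Nullary using (¬_)

------------------------------------------------------------------------
-- Multi-tape Turing machines with a write-only output tape

-- `nothing` is the blank symbol.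
Symbol : Set
Symbol = Maybe Bool

data Move : Set where
  left stay right : Move

-- A two-way infinite tape.  The scanned cell is the first entry of `rightward`;
-- `leftward` lists the cells to its left, nearest first.  All cells beyond the
-- two lists are blank.
record Tape : Set where
  constructor tape
  field
    leftward  : List Symbol
    rightward : List Symbol

scan : Tape → Symbol
scan (tape _ [])      = nothing
scan (tape _ (s ∷ _)) = s

write : Symbol → Tape → Tape
write s (tape l r) = tape l (s ∷ drop 1 r)

move : Move → Tape → Tape
move left  (tape []      r)       = tape [] (nothing ∷ r)
move left  (tape (s ∷ l) r)       = tape l (s ∷ r)
move stay  t                      = t
move right (tape l       [])      = tape (nothing ∷ l) []
move right (tape l       (s ∷ r)) = tape (s ∷ l) r

-- Each transition may append one bit to the output tape; a machine halts when
-- it has no transition.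
record TuringMachine : Set where
  field
    workTapes : ℕ
    states    : ℕ

  tapes : ℕ
  tapes = suc workTapes

  field
    start : Fin states
    δ     : Fin states → Vec Symbol tapes →
            Maybe (Fin states × Vec (Symbol × Move) tapes × Maybe Bool)

  Config : Set
  Config = Fin states × Vec Tape tapes

  initial : List Bool → Config
  initial x = start , tape [] (List.map just x) ∷ Vec.replicate workTapes (tape [] [])

  act : Symbol × Move → Tape → Tape
  act (s , m) t = move m (write s t)

  step : Config → Maybe (Config × Maybe Bool)
  step (q , ts) with δ q (Vec.map scan ts)
  ... | nothing             = nothing
  ... | just (q′ , as , o)  = just ((q′ , Vec.zipWith act as ts) , o)

  emit : Maybe Bool → List Bool → List Bool
  emit nothing  y = y
  emit (just b) y = b ∷ y

  -- `Run c t y`: from `c` the machine halts after exactly `t` steps, during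
  -- which it outputs `y`.
  data Run (c : Config) : ℕ → List Bool → Set where
    halt : step c ≡ nothing → Run c 0 []
    next : ∀ {c′ o t y} → step c ≡ just (c′ , o) → Run c′ t y → Run c (suc t) (emit o y)

-- Polynomial-time computability of the correspondence `input x ↦ output x`,
-- where `x` ranges over a (promise) domain `X`.
PolyTimeComputable : {X : Set} (input output : X → List Bool) → Set
PolyTimeComputable {X} input output =
  Σ TuringMachine λ M → let open TuringMachine M in
  ∃[ c ] ∃[ d ] ((x : X) →
    ∃[ t ] (t ≤ c * suc (length (input x)) ^ d × Run (initial (input x)) t (output x)))

------------------------------------------------------------------------
-- Self-delimiting binary encodings

encodeℕ : ℕ → List Bool
encodeℕ n = replicate n true ++ false ∷ []

encodeBits : List Bool → List Bool
encodeBits []       = false ∷ []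
encodeBits (b ∷ bs) = true ∷ b ∷ encodeBits bs

encodePair : List Bool → List Bool → List Bool
encodePair x y = encodeBits x ++ y

------------------------------------------------------------------------
-- Search problems and reductions

record SearchProblem : Set₁ where
  field
    Instance       : Set
    Solution       : Instance → Set
    encodeInstance : Instance → List Bool
    encodeSolution : ∀ {I} → Solution I → List Bool

PolyTimeReducible : SearchProblem → SearchProblem → Set
PolyTimeReducible P Q =
  Σ (P.Instance → Q.Instance) λ f →
  Σ (∀ I → Q.Solution (f I) → P.Solution I) λ g →
    PolyTimeComputable P.encodeInstance (λ I → Q.encodeInstance (f I)) ×
    PolyTimeComputable {Σ P.Instance λ I → Q.Solution (f I)}
      (λ (I , S) → encodePair (P.encodeInstance I) (Q.encodeSolution S))
      (λ (I , S) → P.encodeSolution (g I S))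
  where
  module P = SearchProblem P
  module Q = SearchProblem Q

------------------------------------------------------------------------
-- Boolean circuits

-- Gates over `w` existing wires.
data Gate (w : ℕ) : Set where
  CONST   : Bool → Gate w
  NOT     : Fin w → Gate w
  AND OR  : Fin w → Fin w → Gate w

-- A circuit in topological order.  Wires are numbered from the most recent one
-- (de Bruijn style), so a new gate becomes wire 0 and shifts all others; in a
-- `Circuit n` without gates, wire i is the i-th input.
data Circuit (w : ℕ) : Set where
  gate    : Gate w → Circuit (suc w) → Circuit w
  outputs : List (Fin w) → Circuit w

evalGate : ∀ {w} → Gate w → Vec Bool w → Bool
evalGate (CONST b) ρ = b
evalGate (NOT i)   ρ = not (lookup ρ i)
evalGate (AND i j) ρ = lookup ρ i ∧ lookup ρ j
evalGate (OR i j)  ρ = lookup ρ i ∨ lookup ρ j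

eval : ∀ {w} → Circuit w → Vec Bool w → List Bool
eval (gate g C)   ρ = eval C (evalGate g ρ ∷ ρ)
eval (outputs is) ρ = List.map (lookup ρ) is

-- Wires are written in unary; as wire numbers are below the number of inputs
-- and gates, this affects the length only polynomially.
encodeWire : ∀ {w} → Fin w → List Bool
encodeWire i = encodeℕ (toℕ i)

encodeGate : ∀ {w} → Gate w → List Bool
encodeGate (CONST b) = false ∷ false ∷ b ∷ []
encodeGate (NOT i)   = false ∷ true ∷ encodeWire i
encodeGate (AND i j) = true ∷ false ∷ encodeWire i ++ encodeWire j
encodeGate (OR i j)  = true ∷ true ∷ encodeWire i ++ encodeWire j

encodeCircuit : ∀ {w} → Circuit w → List Bool
encodeCircuit (gate g C)   = true ∷ encodeGate g ++ encodeCircuit C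
encodeCircuit (outputs is) = false ∷ concatMap (λ i → true ∷ encodeWire i) is ++ false ∷ []

-- Little-endian binary value.
value : List Bool → ℕ
value = foldr (λ b v → (if b then 1 else 0) + 2 * v) 0

-- A subset is given to a circuit as its characteristic vector.
colour : ∀ {n} → Circuit n → Subset n → ℕ
colour C A = value (eval C A)

------------------------------------------------------------------------
-- The problems Kneser and Schrijver

-- The element a of {1,…,n} is represented by the index a - 1 : Fin n.
record Stable {n : ℕ} (A : Subset n) : Set where
  field
    noConsecutive : ∀ {i j} → i ∈ A → j ∈ A → toℕ j ≢ suc (toℕ i)
    notBothEnds   : ∀ {i j} → i ∈ A → j ∈ A → ¬ (toℕ i ≡ 0 × suc (toℕ j) ≡ n)

KSubset : (n k : ℕ) → Subset n → Set
KSubset n k A = ∣ A ∣ ≡ k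

StableKSubset : (n k : ℕ) → Subset n → Set
StableKSubset n k A = KSubset n k A × Stable A

-- Membership in {1,…,m}; no colours exist when m ≤ 0.
_∈[_] : ℕ → ℤ → Set
a ∈[ m ] = 1 ≤ a × + a ℤ.≤ m

module MonochromaticPair (Vertex : (n k : ℕ) → Subset n → Set) (m : ℕ → ℕ → ℤ) where

  record Instance : Set where
    field
      n k        : ℕ
      n-positive : 1 ≤ n
      k-positive : 1 ≤ k
      2k≤n       : 2 * k ≤ n
      circuit    : Circuit n
      colouring  : ∀ A → Vertex n k A → colour circuit A ∈[ m n k ]

  record Solution (I : Instance) : Set where
    open Instance I
    field
      A B        : Subset n
      A-vertex   : Vertex n k A
      B-vertex   : Vertex n k B
      disjoint   : Empty (A ∩ B)
      sameColour : colour circuit A ≡ colour circuit B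

  -- As circuits on n inputs may be much shorter than n, the number n is written
  -- in unary, so that the instance is at least as long as a vertex.
  encodeInstance : Instance → List Bool
  encodeInstance I = encodeℕ n ++ encodeℕ k ++ encodeCircuit circuit
    where open Instance I

  encodeSolution : ∀ {I} → Solution I → List Bool
  encodeSolution S = encodeBits (Vec.toList A) ++ encodeBits (Vec.toList B)
    where open Solution S

  problem : SearchProblem
  problem = record
    { Instance       = Instance
    ; Solution       = Solution
    ; encodeInstance = encodeInstance
    ; encodeSolution = encodeSolution
    }

Kneser : SearchProblem
Kneser = MonochromaticPair.problem KSubset (λ n k → + n ℤ.- + (2 * k) ℤ.+ 1ℤ)

Schrijver : (m : ℕ → ℕ → ℤ) → SearchProblem
Schrijver m = MonochromaticPair.problem StableKSubset m

{-# OPTIONS --safe #-}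
module Submission where

-- Placing the i-th element of {1,…,⌊n/2⌋} at position 2i of {1,…,n} turns every
-- k-subset into a stable one and preserves disjointness, so a colouring of the
-- stable k-subsets of {1,…,n} induces one of all k-subsets of {1,…,⌊n/2⌋}, with
-- exactly the number of colours of the Kneser problem.  The condition
-- 2k ≤ ⌊n/2⌋ holds because otherwise there is no colour for the stable
-- k-subsets, which exist as 2k ≤ n.
--
-- The new circuit recreates the n original inputs by gates and then runs the old
-- circuit.  Since wires are numbered from the most recent one, the old gates keep
-- their encoding, and the machine only has to print a prefix depending on ⌊n/2⌋.

open import Defs
open import Data.Bool using (Bool; true; false; _∨_)
open import Data.Bool.Properties using (∨-identityʳ)
open import Data.Fin using (Fin; zero; suc; toℕ; fromℕ<; inject≤; _↑ʳ_)
open import Data.Fin.Properties using (toℕ-inject≤; toℕ-fromℕ<; toℕ-↑ʳ)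
open import Data.Fin.Subset using (Subset; _∈_; _∩_; ∣_∣; Empty)
open import Data.List using (List; []; _∷_; _++_; length; map; replicate; take; drop; concatMap)
open import Data.List.Properties using (++-assoc; ++-identityʳ; concatMap-++; take-all)
open import Data.Maybe using (Maybe; just; nothing)
open import Data.Nat as ℕ using (ℕ; zero; suc; _*_; _^_; _≤_; z≤n; s≤s; ⌊_/2⌋)
open import Data.Nat.Properties
open import Data.Nat.Tactic.RingSolver using (solve-∀)
open import Data.Product using (∃-syntax; _×_; _,_)
open import Data.Vec as Vec using (Vec; []; _∷_; here; there; lookup; toList; truncate)
open import Data.Vec.Properties
  using (cast-is-id; lookup-truncate; lookup-++ʳ; toList-injective; length-toList)
open import Relation.Binary.PropositionalEquality
  using (_≡_; _≢_; refl; sym; cong; cong₂; subst; subst₂; trans; module ≡-Reasoning)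

-- Runs of a machine with an upper bound on the number of steps

module HaltsWithin (M : TuringMachine) where
  open TuringMachine M

  Halts : Config → List Bool → ℕ → Set
  Halts c y b = ∃[ t ] (t ≤ b × Run c t y)

  halts : ∀ {c b} → step c ≡ nothing → Halts c [] b
  halts s = 0 , z≤n , halt s

  silent : ∀ {c c′ y b} → step c ≡ just (c′ , nothing) → Halts c′ y b → Halts c y (suc b)
  silent s (t , t≤b , r) = suc t , s≤s t≤b , next s r

  emits : ∀ {c c′ y b x} → step c ≡ just (c′ , just x) → Halts c′ y b → Halts c (x ∷ y) (suc b)
  emits s (t , t≤b , r) = suc t , s≤s t≤b , next s r

  relax : ∀ {c y b b′} → b ≤ b′ → Halts c y b → Halts c y b′
  relax b≤b′ (t , t≤b , r) = t , ≤-trans t≤b b≤b′ , r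

-- Running a circuit in the presence of additional older wires

weakenGate : ∀ {m n} → m ≤ n → Gate m → Gate n
weakenGate p (CONST b) = CONST b
weakenGate p (NOT i)   = NOT (inject≤ i p)
weakenGate p (AND i j) = AND (inject≤ i p) (inject≤ j p)
weakenGate p (OR i j)  = OR (inject≤ i p) (inject≤ j p)

-- `inject≤` keeps the number of a wire, and numbers count from the newest wire. So the weakened
-- circuit reads the m newest wires and ignores the older ones; on values this is `truncate`.
weaken : ∀ {m n} → m ≤ n → Circuit m → Circuit n
weaken p (gate g C)   = gate (weakenGate p g) (weaken (s≤s p) C)
weaken p (outputs is) = outputs (map (λ i → inject≤ i p) is)

evalGate-weaken : ∀ {m n} (p : m ≤ n) g ρ → evalGate (weakenGate p g) ρ ≡ evalGate g (truncate p ρ)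
evalGate-weaken p (CONST b) ρ = refl
evalGate-weaken p (NOT i)   ρ rewrite lookup-truncate p ρ i = refl
evalGate-weaken p (AND i j) ρ rewrite lookup-truncate p ρ i | lookup-truncate p ρ j = refl
evalGate-weaken p (OR i j)  ρ rewrite lookup-truncate p ρ i | lookup-truncate p ρ j = refl

eval-weaken : ∀ {m n} (p : m ≤ n) C ρ → eval (weaken p C) ρ ≡ eval C (truncate p ρ)
eval-weaken p (gate g C)         ρ = trans (eval-weaken (s≤s p) C _)
  (cong (λ b → eval C (b ∷ truncate p ρ)) (evalGate-weaken p g ρ))
eval-weaken p (outputs [])       ρ = refl
eval-weaken p (outputs (i ∷ is)) ρ = cong₂ _∷_ (sym (lookup-truncate p ρ i)) (eval-weaken p (outputs is) ρ)

encodeWire-inject≤ : ∀ {m n} (p : m ≤ n) (i : Fin m) → encodeWire (inject≤ i p) ≡ encodeWire i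
encodeWire-inject≤ p i = cong encodeℕ (toℕ-inject≤ i p)

encodeGate-weaken : ∀ {m n} (p : m ≤ n) g → encodeGate (weakenGate p g) ≡ encodeGate g
encodeGate-weaken p (CONST b) = refl
encodeGate-weaken p (NOT i)   rewrite encodeWire-inject≤ p i = refl
encodeGate-weaken p (AND i j) rewrite encodeWire-inject≤ p i | encodeWire-inject≤ p j = refl
encodeGate-weaken p (OR i j)  rewrite encodeWire-inject≤ p i | encodeWire-inject≤ p j = refl

encodeCircuit-weaken : ∀ {m n} (p : m ≤ n) C → encodeCircuit (weaken p C) ≡ encodeCircuit C
encodeCircuit-weaken p (gate g C) =
  cong (true ∷_) (cong₂ _++_ (encodeGate-weaken p g) (encodeCircuit-weaken (s≤s p) C))
encodeCircuit-weaken p (outputs is) = cong (λ z → false ∷ z ++ false ∷ []) (go is)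
  where
  go : ∀ is → concatMap (λ i → true ∷ encodeWire i) (map (λ i → inject≤ i p) is) ≡
              concatMap (λ i → true ∷ encodeWire i) is
  go []       = refl
  go (i ∷ is) = cong₂ (λ x y → true ∷ x ++ y) (encodeWire-inject≤ p i) (go is)

-- Characteristic vectors of spread sets

spread : ∀ n → Vec Bool ⌊ n /2⌋ → Vec Bool n
spread zero          []       = []
spread (suc zero)    []       = false ∷ []
spread (suc (suc n)) (x ∷ xs) = false ∷ x ∷ spread n xs

interleave : List Bool → List Bool
interleave = concatMap (λ x → false ∷ x ∷ [])

-- The interleaving has 2⌊n/2⌋ entries, so `take n` stops right after it for even n and after the
-- extra `false` for odd n. The list on the right has the shape of the wires at the end of the new
-- gates, whatever older wires `z` follow.
toList-spread : ∀ n xs z → toList (spread n xs) ≡ take n (interleave (toList xs) ++ false ∷ z)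
toList-spread zero          []       z = refl
toList-spread (suc zero)    []       z = refl
toList-spread (suc (suc n)) (x ∷ xs) z = cong (λ w → false ∷ x ∷ w) (toList-spread n xs z)

toList-truncate : ∀ {m n} (p : m ≤ n) (xs : Vec Bool n) → toList (truncate p xs) ≡ take m (toList xs)
toList-truncate z≤n     xs       = refl
toList-truncate (s≤s p) (x ∷ xs) = cong (x ∷_) (toList-truncate p xs)

take-suc-toList : ∀ {n} (xs : Vec Bool n) i →
  take (suc (toℕ i)) (toList xs) ≡ take (toℕ i) (toList xs) ++ lookup xs i ∷ []
take-suc-toList (x ∷ xs) zero    = refl
take-suc-toList (x ∷ xs) (suc i) = cong (x ∷_) (take-suc-toList xs i)

-- The circuit on ⌊n/2⌋ inputs: its gates, encoding and values

module PadCircuit where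
  open import Data.Nat using (_+_)

  -- Here `a` counts the remaining OR gates and `m` is the number of the wire copied next. The
  -- inputs are copied from the last to the first, which lowers the number by one, while two new
  -- gates raise it by two; hence `suc m`. The `false` after `encodeℕ m` is wire 0, the second
  -- operand.
  prefixBits : ℕ → ℕ → List Bool → List Bool
  prefixBits a m z = true ∷ false ∷ false ∷ false ∷ ors a
    where
    ors : ℕ → List Bool
    ors zero    = z
    ors (suc a) = true ∷ true ∷ true ∷ encodeℕ m ++ false ∷ prefixBits a (suc m) z

  two-more : ∀ a w → 1 + (suc a + suc a + w) ≡ 1 + (a + a + (2 + w))
  two-more = solve-∀

  module _ {n h : ℕ} (C : Circuit n) where

    -- The last h wires are the inputs, of which the first a are still to be copied.
    -- The OR gate copies one, since wire 0 is the constant false made just before.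
    spreadGates : ∀ a e → a ≤ h → n ≤ suc (a + a + (e + h)) → Circuit (e + h)
    spreadGates zero    e a≤h p = gate (CONST false) (weaken p C)
    spreadGates (suc a) e a<h p =
      gate (CONST false) (gate (OR (suc e ↑ʳ fromℕ< a<h) zero)
        (spreadGates a (2 + e) (<⇒≤ a<h) (subst (n ≤_) (two-more a (e + h)) p)))

    encodeCircuit-spreadGates : ∀ a e a≤h p →
      encodeCircuit (spreadGates a e a≤h p) ≡ prefixBits a (e + a) (encodeCircuit C)
    encodeCircuit-spreadGates zero    e a≤h p =
      cong (λ z → true ∷ false ∷ false ∷ false ∷ z) (encodeCircuit-weaken p C)
    encodeCircuit-spreadGates (suc a) e a<h p =
      cong (λ z → true ∷ false ∷ false ∷ false ∷ true ∷ true ∷ true ∷ z)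
        (trans (++-assoc (encodeℕ (toℕ (suc e ↑ʳ fromℕ< a<h))) (false ∷ []) _)
        (cong₂ (λ m z → encodeℕ m ++ false ∷ z)
          wire-number
          (trans (encodeCircuit-spreadGates a (2 + e) (<⇒≤ a<h) _)
            (cong (λ m → prefixBits a (suc m) (encodeCircuit C)) (sym (+-suc e a))))))
      where
      wire-number : toℕ (suc e ↑ʳ fromℕ< a<h) ≡ e + suc a
      wire-number = trans (toℕ-↑ʳ (suc e) (fromℕ< a<h))
        (trans (cong (suc e +_) (toℕ-fromℕ< a<h)) (sym (+-suc e a)))

    -- The hypothesis on `D` is a loop invariant: in front of the present wires `E` and `A` there
    -- will be the pending constant `false` and, before it, the interleaving of the bits still to be
    -- copied. One round turns the pending `false` and the last of these bits into wires, and the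
    -- `false` paired with that bit becomes the pending one.
    eval-spreadGates : ∀ a e a≤h p (E : Vec Bool e) (A : Vec Bool h) (D : Vec Bool n) →
      toList D ≡ take n (interleave (take a (toList A)) ++ false ∷ toList (E Vec.++ A)) →
      eval (spreadGates a e a≤h p) (E Vec.++ A) ≡ eval C D
    eval-spreadGates zero    e a≤h p E A D D≡ =
      trans (eval-weaken p C _)
        (cong (eval C) (trans (sym (cast-is-id refl _))
          (toList-injective refl _ D (trans (toList-truncate p (false ∷ E Vec.++ A)) (sym D≡)))))
    eval-spreadGates (suc a) e a<h p E A D D≡ =
      eval-spreadGates a (2 + e) (<⇒≤ a<h) _ (x ∷ false ∷ E) A D (trans D≡ (cong (take n) eq))
      where
      i = fromℕ< a<h
      x = lookup (false ∷ E Vec.++ A) (suc e ↑ʳ i) ∨ false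
      x≡ : lookup A i ≡ x
      x≡ = sym (trans (∨-identityʳ _) (lookup-++ʳ (false ∷ E) A i))
      take≡ : take (suc a) (toList A) ≡ take a (toList A) ++ lookup A i ∷ []
      take≡ = subst (λ j → take (suc j) (toList A) ≡ take j (toList A) ++ lookup A i ∷ [])
        (toℕ-fromℕ< a<h) (take-suc-toList A i)
      open ≡-Reasoning
      Z = false ∷ toList (E Vec.++ A)
      eq : interleave (take (suc a) (toList A)) ++ Z ≡ interleave (take a (toList A)) ++ false ∷ x ∷ Z
      eq = begin
        interleave (take (suc a) (toList A)) ++ Z
          ≡⟨ cong (λ w → interleave w ++ Z) take≡ ⟩
        interleave (take a (toList A) ++ lookup A i ∷ []) ++ Z
          ≡⟨ cong (_++ Z) (concatMap-++ (λ x → false ∷ x ∷ []) (take a (toList A)) (lookup A i ∷ [])) ⟩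
        (interleave (take a (toList A)) ++ false ∷ lookup A i ∷ []) ++ Z
          ≡⟨ ++-assoc (interleave (take a (toList A))) _ Z ⟩
        interleave (take a (toList A)) ++ false ∷ lookup A i ∷ Z
          ≡⟨ cong (λ x → interleave (take a (toList A)) ++ false ∷ x ∷ Z) x≡ ⟩
        interleave (take a (toList A)) ++ false ∷ x ∷ Z ∎

  padCircuit : ∀ {n} → Circuit n → Circuit ⌊ n /2⌋
  padCircuit {n} C = spreadGates C ⌊ n /2⌋ 0 ≤-refl n≤
    where
    open ≤-Reasoning
    -- The ⌊n/2⌋ copies and ⌊n/2⌋ + 1 constants already provide n wires, without counting the
    -- inputs.
    n≤ : n ≤ suc (⌊ n /2⌋ + ⌊ n /2⌋ + ⌊ n /2⌋)
    n≤ = begin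
      n ≡⟨ ⌊n/2⌋+⌈n/2⌉≡n n ⟨
      ⌊ n /2⌋ + ⌊ suc n /2⌋ ≤⟨ +-monoʳ-≤ ⌊ n /2⌋ (⌊n/2⌋-mono (n≤1+n (suc n))) ⟩
      ⌊ n /2⌋ + suc ⌊ n /2⌋ ≡⟨ +-suc ⌊ n /2⌋ ⌊ n /2⌋ ⟩
      suc (⌊ n /2⌋ + ⌊ n /2⌋) ≤⟨ s≤s (m≤m+n _ _) ⟩
      suc (⌊ n /2⌋ + ⌊ n /2⌋ + ⌊ n /2⌋) ∎

  encodeCircuit-padCircuit : ∀ {n} (C : Circuit n) →
    encodeCircuit (padCircuit C) ≡ prefixBits ⌊ n /2⌋ ⌊ n /2⌋ (encodeCircuit C)
  encodeCircuit-padCircuit {n} C = encodeCircuit-spreadGates C ⌊ n /2⌋ 0 ≤-refl _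

  eval-padCircuit : ∀ {n} (C : Circuit n) A → eval (padCircuit C) A ≡ eval C (spread n A)
  eval-padCircuit {n} C A = eval-spreadGates C ⌊ n /2⌋ 0 ≤-refl _ [] A (spread n A)
    (trans (toList-spread n A (toList A))
      (cong (λ w → take n (interleave w ++ false ∷ toList A))
        (sym (take-all ⌊ n /2⌋ (toList A) (≤-reflexive (length-toList A))))))

  -- The machine that prints the Kneser instance, and its running time

  length-encodeℕ-++ : ∀ n z → length (encodeℕ n ++ z) ≡ suc n + length z
  length-encodeℕ-++ zero    z = refl
  length-encodeℕ-++ (suc n) z = cong suc (length-encodeℕ-++ n z)

  pattern even = zero
  pattern odd = suc even
  pattern copyK = suc odd
  pattern const₁ = suc copyK
  pattern const₂ = suc const₁
  pattern const₃ = suc const₂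
  pattern const₄ = suc const₃
  pattern check = suc const₄
  pattern or₂ = suc check
  pattern or₃ = suc or₂
  pattern wire = suc or₃
  pattern wire₀ = suc wire
  pattern rewind = suc wire₀
  pattern copy = suc rewind

  private
    one : Symbol
    one = just true

    blank delim : Symbol × Move
    blank = nothing , stay
    delim = just false , stay

    -- The state `even` leaves ⌊n/2⌋ ones on both work tapes.  The first counts the
    -- OR gates still to be printed, the second is the number of the next wire to be
    -- copied.  Between `copyK` and `copy` the input head rests on the final `false`
    -- of encodeℕ k.
    δ : Fin 14 → Vec Symbol 3 → Maybe (Fin 14 × Vec (Symbol × Move) 3 × Maybe Bool)
    δ even  (just true  ∷ _ ∷ _ ∷ []) = just (odd , (one , right) ∷ blank ∷ blank ∷ [] , nothing)
    δ even  (just false ∷ _ ∷ _ ∷ []) = just (copyK , (just false , right) ∷ blank ∷ blank ∷ [] , just false)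
    δ odd   (just true  ∷ _ ∷ _ ∷ []) = just (even , (one , right) ∷ (one , right) ∷ (one , right) ∷ [] , just true)
    δ odd   (just false ∷ _ ∷ _ ∷ []) = just (copyK , (just false , right) ∷ blank ∷ blank ∷ [] , just false)
    δ copyK (just true  ∷ _ ∷ _ ∷ []) = just (copyK , (one , right) ∷ blank ∷ blank ∷ [] , just true)
    δ copyK (just false ∷ _ ∷ _ ∷ []) = just (const₁ , delim ∷ blank ∷ blank ∷ [] , just false)
    δ const₁ (_ ∷ _ ∷ _ ∷ []) = just (const₂ , delim ∷ blank ∷ blank ∷ [] , just true)
    δ const₂ (_ ∷ _ ∷ _ ∷ []) = just (const₃ , delim ∷ blank ∷ blank ∷ [] , just false)
    δ const₃ (_ ∷ _ ∷ _ ∷ []) = just (const₄ , delim ∷ blank ∷ blank ∷ [] , just false)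
    δ const₄ (_ ∷ _ ∷ _ ∷ []) = just (check , delim ∷ (nothing , left) ∷ blank ∷ [] , just false)
    δ check (_ ∷ just _  ∷ _ ∷ []) = just (or₂ , delim ∷ blank ∷ blank ∷ [] , just true)
    δ check (_ ∷ nothing ∷ _ ∷ []) = just (copy , (just false , right) ∷ blank ∷ blank ∷ [] , nothing)
    δ or₂ (_ ∷ _ ∷ _ ∷ []) = just (or₃ , delim ∷ blank ∷ blank ∷ [] , just true)
    δ or₃ (_ ∷ _ ∷ _ ∷ []) = just (wire , delim ∷ blank ∷ (nothing , left) ∷ [] , just true)
    δ wire (_ ∷ _ ∷ just _  ∷ []) = just (wire , delim ∷ blank ∷ (one , left) ∷ [] , just true)
    δ wire (_ ∷ _ ∷ nothing ∷ []) = just (wire₀ , delim ∷ blank ∷ (one , stay) ∷ [] , just false)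
    δ wire₀ (_ ∷ _ ∷ _ ∷ []) = just (rewind , delim ∷ blank ∷ (one , right) ∷ [] , just false)
    δ rewind (_ ∷ _ ∷ just _  ∷ []) = just (rewind , delim ∷ blank ∷ (one , right) ∷ [] , nothing)
    δ rewind (_ ∷ _ ∷ nothing ∷ []) = just (const₁ , delim ∷ blank ∷ blank ∷ [] , nothing)
    δ copy (just b ∷ _ ∷ _ ∷ []) = just (copy , (just b , right) ∷ blank ∷ blank ∷ [] , just b)
    δ _ _ = nothing

  machine : TuringMachine
  machine = record { workTapes = 2 ; states = 14 ; start = even ; δ = δ }

  open TuringMachine machine using (initial)
  open HaltsWithin machine

  ones : ℕ → List Symbol
  ones m = replicate m one

  -- The rest of the run is a hypothesis for every `l`, as the input head never moves left. The work
  -- heads end just behind the ones, on a blank that the last transition writes explicitly.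
  run-even : ∀ n l m z {h y b} → ⌊ n /2⌋ + m ≡ h →
             (∀ l → Halts (copyK , tape l (map just z) ∷ tape (ones h) (nothing ∷ [])
                                   ∷ tape (ones h) (nothing ∷ []) ∷ []) y b) →
             Halts (even , tape l (map just (encodeℕ n ++ z)) ∷ tape (ones m) [] ∷ tape (ones m) [] ∷ [])
                   (encodeℕ ⌊ n /2⌋ ++ y) (suc n + b)
  run-even zero          l m z refl k = emits refl (k _)
  run-even (suc zero)    l m z refl k = silent refl (emits refl (k _))
  run-even (suc (suc n)) l m z eq   k =
    silent refl (emits refl (run-even n _ (suc m) z (trans (+-suc ⌊ n /2⌋ m) eq) k))

  run-copyK : ∀ k l m z {y b} →
              (∀ l → Halts (const₁ , tape l (just false ∷ map just z) ∷ tape (ones m) (nothing ∷ [])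
                                     ∷ tape (ones m) (nothing ∷ []) ∷ []) y b) →
              Halts (copyK , tape l (map just (encodeℕ k ++ z)) ∷ tape (ones m) (nothing ∷ [])
                             ∷ tape (ones m) (nothing ∷ []) ∷ [])
                    (encodeℕ k ++ y) (suc k + b)
  run-copyK zero    l m z h = emits refl (h _)
  run-copyK (suc k) l m z h = emits refl (run-copyK k _ m z h)

  run-copy : ∀ z {l S T} → Halts (copy , tape l (map just z) ∷ S ∷ T ∷ []) z (length z)
  run-copy []      = halts refl
  run-copy (b ∷ z) = emits refl (run-copy z)

  -- The head walks left over the ones, printing each, to the blank before them. Overwriting this
  -- blank with a one increments the counter for the next round.
  run-wire : ∀ a b {c l z u v w y t} → a + b ≡ c →
             Halts (wire₀ , tape l (just false ∷ z) ∷ tape u (nothing ∷ v)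
                            ∷ tape [] (ones (suc c) ++ w) ∷ []) y t →
             Halts (wire , tape l (just false ∷ z) ∷ tape u (nothing ∷ v)
                           ∷ move left (tape (ones a) (ones b ++ w)) ∷ [])
                   (encodeℕ a ++ y) (suc a + t)
  run-wire zero    b refl h = emits refl h
  run-wire (suc a) b eq   h = emits refl (run-wire a (suc b) (trans (+-suc a b) eq) h)

  run-rewind : ∀ a b {c l z u v w y t} → a + b ≡ c →
               Halts (const₁ , tape l (just false ∷ z) ∷ tape u (nothing ∷ v)
                               ∷ tape (ones c) (nothing ∷ w) ∷ []) y t →
               Halts (rewind , tape l (just false ∷ z) ∷ tape u (nothing ∷ v)
                               ∷ tape (ones b) (ones a ++ nothing ∷ w) ∷ [])
                     y (suc a + t)
  run-rewind zero    b refl h = silent refl h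
  run-rewind (suc a) b eq   h = silent refl (run-rewind a (suc b) (trans (+-suc a b) eq) h)

  -- Each round erases a one of the first counter and adds one to the second, so `a + m` is
  -- invariant and `N` bounds `m` throughout. A round takes 10 + 2m steps: seven up to `wire`, two
  -- passes over the second counter with m + 1 steps each, and one in `wire₀`.
  run-const : ∀ a m {N} z {l v w} → a + m ≤ N →
              Halts (const₁ , tape l (just false ∷ map just z) ∷ tape (ones a) (nothing ∷ v)
                              ∷ tape (ones m) (nothing ∷ w) ∷ [])
                    (prefixBits a m z) (a * (10 + (N + N)) + (5 + length z))
  run-const zero    m z _ = emits refl (emits refl (emits refl (emits refl (silent refl (run-copy z)))))
  run-const (suc a) m {N} z {w = w} a+m≤N = relax bound
    (emits refl (emits refl (emits refl (emits refl (emits refl (emits refl (emits refl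
      (run-wire m 0 (+-identityʳ m)
        (emits refl (run-rewind m 1 (+-comm m 1)
          (run-const a (suc m) z (subst (_≤ N) (sym (+-suc a m)) a+m≤N))))))))))))
    where
    open ≤-Reasoning
    m≤N : m ≤ N
    m≤N = ≤-trans (m≤n+m m (suc a)) a+m≤N
    X = a * (10 + (N + N)) + (5 + length z)
    bound : 7 + (suc m + (1 + (suc m + X))) ≤ suc a * (10 + (N + N)) + (5 + length z)
    bound = begin
      7 + (suc m + (1 + (suc m + X)))  ≡⟨ cong (8 +_) (+-suc m (suc m + X)) ⟩
      9 + (m + (suc m + X))            ≡⟨ cong (9 +_) (+-assoc m (suc m) X) ⟨
      9 + (m + suc m + X)              ≡⟨ cong (λ i → 9 + (i + X)) (+-suc m m) ⟩
      10 + (m + m + X)                 ≤⟨ +-monoʳ-≤ 10 (+-monoˡ-≤ X (+-mono-≤ m≤N m≤N)) ⟩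
      (10 + (N + N)) + X               ≡⟨ +-assoc (10 + (N + N)) (a * (10 + (N + N))) (5 + length z) ⟨
      suc a * (10 + (N + N)) + (5 + length z) ∎

  time : ∀ n k z → suc n + (suc k + (⌊ n /2⌋ * (10 + (n + n)) + (5 + length z)))
                   ≤ 15 * suc (length (encodeℕ n ++ encodeℕ k ++ z)) ^ 2
  time n k z = begin
    suc n + (suc k + (⌊ n /2⌋ * (10 + (n + n)) + (5 + length z)))
      ≡⟨ regroup (suc n) (suc k) (⌊ n /2⌋ * (10 + (n + n))) (length z) ⟩
    (5 + (suc n + (suc k + length z))) + ⌊ n /2⌋ * (10 + (n + n))
      ≡⟨ cong (λ i → (5 + i) + ⌊ n /2⌋ * (10 + (n + n))) length-input ⟨
    (5 + L) + ⌊ n /2⌋ * (10 + (n + n))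
      ≤⟨ +-mono-≤ (+-monoʳ-≤ 5 (m≤n*m L 5))
                  (*-mono-≤ (≤-trans (⌊n/2⌋≤n n) n≤L) (+-monoʳ-≤ 10 (+-mono-≤ n≤L n≤L))) ⟩
    (5 + 5 * L) + L * (10 + (L + L))
      -- The added term is what 2L² + 15L + 5 lacks to 15(L + 1)².
      ≤⟨ m≤m+n _ (13 * (L * L) + 15 * L + 10) ⟩
    ((5 + 5 * L) + L * (10 + (L + L))) + (13 * (L * L) + 15 * L + 10)
      ≡⟨ square L ⟩
    15 * suc L ^ 2 ∎
    where
    open ≤-Reasoning
    L = length (encodeℕ n ++ encodeℕ k ++ z)
    length-input : L ≡ suc n + (suc k + length z)
    length-input = trans (length-encodeℕ-++ n (encodeℕ k ++ z)) (cong (suc n +_) (length-encodeℕ-++ k z))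
    n≤L : n ≤ L
    n≤L = ≤-trans (n≤1+n n) (≤-trans (m≤m+n (suc n) _) (≤-reflexive (sym length-input)))
    regroup : ∀ a b c d → a + (b + (c + (5 + d))) ≡ (5 + (a + (b + d))) + c
    regroup = solve-∀
    square : ∀ L → ((5 + 5 * L) + L * (10 + (L + L))) + (13 * (L * L) + 15 * L + 10) ≡
                   15 * (suc L * (suc L * 1))
    square = solve-∀

  correct : ∀ n k (C : Circuit n) → let input = encodeℕ n ++ encodeℕ k ++ encodeCircuit C in
            Halts (initial input) (encodeℕ ⌊ n /2⌋ ++ encodeℕ k ++ encodeCircuit (padCircuit C))
                  (15 * suc (length input) ^ 2)
  correct n k C rewrite encodeCircuit-padCircuit C = relax (time n k (encodeCircuit C))
    (run-even n [] 0 _ (+-identityʳ ⌊ n /2⌋) λ l → run-copyK k l _ _ λ l →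
      run-const ⌊ n /2⌋ ⌊ n /2⌋ (encodeCircuit C)
        -- Both counters start at ⌊n/2⌋, so their sum is bounded by `N` = n.
        (≤-trans (+-monoʳ-≤ ⌊ n /2⌋ (⌊n/2⌋≤⌈n/2⌉ n)) (≤-reflexive (⌊n/2⌋+⌈n/2⌉≡n n))))

-- The machine that spreads a Kneser solution

module SpreadSolution where
  open import Data.Nat using (_+_)

  pattern evenTag = zero
  pattern evenBit = suc evenTag
  pattern oddTag = suc evenBit
  pattern oddBit = suc oddTag
  pattern skipTag = suc oddBit
  pattern skipBit = suc skipTag
  pattern copyTag = suc skipBit
  pattern pad₂ = suc copyTag
  pattern pad₃ = suc pad₂
  pattern copyBit = suc pad₃
  pattern last₂ = suc copyBit
  pattern last₃ = suc last₂

  private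
    blank : Symbol × Move
    blank = nothing , stay

    -- The work tape is blank for even n and holds a one for odd n.  The encodings
    -- of both sets are copied by the same states, as only the second is followed by
    -- a blank, on which `copyTag` halts.
    δ : Fin 12 → Vec Symbol 2 → Maybe (Fin 12 × Vec (Symbol × Move) 2 × Maybe Bool)
    δ evenTag (s ∷ _ ∷ [])          = just (evenBit , (s , right) ∷ blank ∷ [] , nothing)
    δ evenBit (just true  ∷ _ ∷ []) = just (oddTag , (just true , right) ∷ blank ∷ [] , nothing)
    δ evenBit (just false ∷ _ ∷ []) = just (skipTag , (just false , right) ∷ blank ∷ [] , nothing)
    δ oddTag (s ∷ _ ∷ [])           = just (oddBit , (s , right) ∷ blank ∷ [] , nothing)
    δ oddBit (just true  ∷ _ ∷ [])  = just (evenTag , (just true , right) ∷ blank ∷ [] , nothing)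
    δ oddBit (just false ∷ _ ∷ [])  = just (skipTag , (just false , right) ∷ (just true , stay) ∷ [] , nothing)
    δ skipTag (just true  ∷ p ∷ []) = just (skipBit , (just true , right) ∷ (p , stay) ∷ [] , nothing)
    δ skipTag (just false ∷ p ∷ []) = just (copyTag , (just false , right) ∷ (p , stay) ∷ [] , nothing)
    δ skipBit (s ∷ p ∷ [])          = just (skipTag , (s , right) ∷ (p , stay) ∷ [] , nothing)
    δ copyTag (just true  ∷ p ∷ []) = just (pad₂ , (just true , right) ∷ (p , stay) ∷ [] , just true)
    δ copyTag (just false ∷ just p  ∷ []) = just (last₂ , (just false , stay) ∷ (just p , stay) ∷ [] , just true)
    δ copyTag (just false ∷ nothing ∷ []) = just (copyTag , (just false , right) ∷ blank ∷ [] , just false)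
    δ pad₂ (s ∷ p ∷ [])             = just (pad₃ , (s , stay) ∷ (p , stay) ∷ [] , just false)
    δ pad₃ (s ∷ p ∷ [])             = just (copyBit , (s , stay) ∷ (p , stay) ∷ [] , just true)
    δ copyBit (just b  ∷ p ∷ [])    = just (copyTag , (just b , right) ∷ (p , stay) ∷ [] , just b)
    δ last₂ (s ∷ p ∷ [])            = just (last₃ , (s , stay) ∷ (p , stay) ∷ [] , just false)
    δ last₃ (s ∷ p ∷ [])            = just (copyTag , (s , right) ∷ (p , stay) ∷ [] , just false)
    δ _ _ = nothing

  machine : TuringMachine
  machine = record { workTapes = 1 ; states = 12 ; start = evenTag ; δ = δ }

  open TuringMachine machine using (initial; Config)
  open HaltsWithin machine

  parity : ℕ → Symbol
  parity zero          = nothing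
  parity (suc zero)    = just true
  parity (suc (suc n)) = parity n

  config : Fin 12 → List Symbol → List Bool → List Symbol → Config
  config q l z w = q , tape l (map just z) ∷ tape [] w ∷ []

  private
    -- The budget is three steps per input cell; a cell left after one step forfeits two.
    wait₂ : ∀ {c y b} → Halts c y b → Halts c y (2 + b)
    wait₂ = relax (m≤n+m _ 2)

  run-even : ∀ n x z l w {y} →
             (∀ l → Halts (config skipTag l (encodeBits x ++ z) (parity n ∷ drop 1 w)) y
                          (length (encodeBits x ++ z) * 3)) →
             Halts (config evenTag l (encodeBits (encodeℕ n ++ x) ++ z) w) y
                   (length (encodeBits (encodeℕ n ++ x) ++ z) * 3)
  run-even zero          x z l w h = wait₂ (wait₂ (silent refl (silent refl (h _))))
  run-even (suc zero)    x z l w h =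
    wait₂ (wait₂ (wait₂ (wait₂ (silent refl (silent refl (silent refl (silent refl (h _))))))))
  run-even (suc (suc n)) x z l w h =
    wait₂ (wait₂ (wait₂ (wait₂ (silent refl (silent refl (silent refl (silent refl (run-even n x z _ _ h))))))))

  run-skip : ∀ x z {l p y} →
             (∀ l → Halts (config copyTag l z (p ∷ [])) y (length z * 3)) →
             Halts (config skipTag l (encodeBits x ++ z) (p ∷ [])) y (length (encodeBits x ++ z) * 3)
  run-skip []      z h = wait₂ (silent refl (h _))
  run-skip (b ∷ x) z h = wait₂ (wait₂ (silent refl (silent refl (run-skip x z h))))

  -- The ⌊n/2⌋ bits of a set do not determine n, so the stored parity decides at the end mark
  -- whether one more `false` is output. The cells that need all three steps are each copied bit
  -- and, for odd n, the end mark.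
  run-copy : ∀ n (A : Vec Bool ⌊ n /2⌋) z {l y} →
             (∀ l → Halts (config copyTag l z (parity n ∷ [])) y (length z * 3)) →
             Halts (config copyTag l (encodeBits (toList A) ++ z) (parity n ∷ []))
                   (encodeBits (toList (spread n A)) ++ y) (length (encodeBits (toList A) ++ z) * 3)
  run-copy zero          []      z h = wait₂ (emits refl (h _))
  run-copy (suc zero)    []      z h = emits refl (emits refl (emits refl (h _)))
  run-copy (suc (suc n)) (b ∷ A) z h =
    wait₂ (emits refl (emits refl (emits refl (emits refl (run-copy n A z h)))))

  correct : ∀ n x (A B : Vec Bool ⌊ n /2⌋) →
    let input = encodePair (encodeℕ n ++ x) (encodeBits (toList A) ++ encodeBits (toList B)) in
    Halts (initial input)
          (encodeBits (toList (spread n A)) ++ encodeBits (toList (spread n B)))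
          (3 * suc (length input) ^ 1)
  correct n x A B = relax bound
    (run-even n x _ [] [] λ l → run-skip x _ λ l → run-copy n A _ λ l →
      -- The second set ends the input, so both the remaining input and the later output are empty.
      subst₂ (λ z y → Halts (config copyTag l z (parity n ∷ [])) y (length z * 3))
        (++-identityʳ _) (++-identityʳ _) (run-copy n B [] λ l → halts refl))
    where
    input = encodePair (encodeℕ n ++ x) (encodeBits (toList A) ++ encodeBits (toList B))
    open ≤-Reasoning
    bound : length input * 3 ≤ 3 * suc (length input) ^ 1
    bound = begin
      length input * 3            ≡⟨ *-comm (length input) 3 ⟩
      3 * length input            ≤⟨ *-monoʳ-≤ 3 (n≤1+n (length input)) ⟩
      3 * suc (length input)      ≡⟨ cong (3 *_) (*-identityʳ (suc (length input))) ⟨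
      3 * suc (length input) ^ 1  ∎

-- Spread sets are stable, and the colour count forces 2k ≤ ⌊n/2⌋

open import Data.Integer using (+_; _-_; _+_; 1ℤ)
import Data.Integer as ℤ
import Data.Integer.Properties as ℤ

open PadCircuit using (padCircuit; eval-padCircuit)

∈-spread⁻ : ∀ n (A : Subset ⌊ n /2⌋) {i} → i ∈ spread n A →
  ∃[ j ] (j ∈ A × toℕ i ≡ suc (toℕ j ℕ.+ toℕ j))
∈-spread⁻ (suc zero)    []      (there ())
∈-spread⁻ (suc (suc n)) (_ ∷ A) (there here) = zero , here , refl
∈-spread⁻ (suc (suc n)) (_ ∷ A) (there (there i∈)) with j , j∈A , i≡ ← ∈-spread⁻ n A i∈ =
  suc j , there j∈A , cong (λ m → suc (suc m)) (trans i≡ (sym (+-suc (toℕ j) (toℕ j))))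

∣spread∣ : ∀ n (A : Subset ⌊ n /2⌋) → ∣ spread n A ∣ ≡ ∣ A ∣
∣spread∣ zero          []          = refl
∣spread∣ (suc zero)    []          = refl
∣spread∣ (suc (suc n)) (true  ∷ A) = cong suc (∣spread∣ n A)
∣spread∣ (suc (suc n)) (false ∷ A) = ∣spread∣ n A

spread-∩ : ∀ n (A B : Subset ⌊ n /2⌋) → spread n A ∩ spread n B ≡ spread n (A ∩ B)
spread-∩ zero          []      []      = refl
spread-∩ (suc zero)    []      []      = refl
spread-∩ (suc (suc n)) (a ∷ A) (b ∷ B) = cong (λ C → false ∷ _ ∷ C) (spread-∩ n A B)

spread-empty : ∀ n (A B : Subset ⌊ n /2⌋) → Empty (A ∩ B) → Empty (spread n A ∩ spread n B)
spread-empty n A B empty (i , i∈) with j , j∈ , _ ← ∈-spread⁻ n (A ∩ B) (subst (i ∈_) (spread-∩ n A B) i∈) =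
  empty (j , j∈)

m+m≢1+n+n : ∀ m n → m ℕ.+ m ≢ suc (n ℕ.+ n)
m+m≢1+n+n m n eq = even≢odd m n (trans (cong (m ℕ.+_) (+-identityʳ m))
  (trans eq (cong (λ i → suc (n ℕ.+ i)) (sym (+-identityʳ n)))))

-- All indices in a spread set are odd: two of them never differ by one, and index 0, which is the
-- element 1, does not occur.
spread-stable : ∀ n (A : Subset ⌊ n /2⌋) → Stable (spread n A)
spread-stable n A = record
  { noConsecutive = λ i∈ j∈ j≡i+1 →
      let (i′ , _ , i≡) = ∈-spread⁻ n A i∈
          (j′ , _ , j≡) = ∈-spread⁻ n A j∈
      in m+m≢1+n+n (toℕ j′) (toℕ i′) (suc-injective (trans (sym j≡) (trans j≡i+1 (cong suc i≡))))
  ; notBothEnds = λ i∈ j∈ (i≡0 , _) →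
      let (_ , _ , i≡) = ∈-spread⁻ n A i∈ in 1+n≢0 (trans (sym i≡) i≡0)
  }

spread-vertex : ∀ n k (A : Subset ⌊ n /2⌋) → KSubset ⌊ n /2⌋ k A → StableKSubset n k (spread n A)
spread-vertex n k A ∣A∣≡k = trans (∣spread∣ n A) ∣A∣≡k , spread-stable n A

-- Provides a vertex, whose colour then witnesses that the set of colours is nonempty.
exists-KSubset : ∀ {n k} → k ≤ n → ∃[ A ] KSubset n k A
exists-KSubset {zero}  z≤n = [] , refl
exists-KSubset {suc n} z≤n with A , ∣A∣≡0 ← exists-KSubset {n} z≤n = false ∷ A , ∣A∣≡0
exists-KSubset (s≤s k≤n) with A , ∣A∣≡k ← exists-KSubset k≤n = true ∷ A , cong suc ∣A∣≡k

colour⇒2k≤n : ∀ {n k a} → a ∈[ + n - + (2 * k) + 1ℤ ] → 2 * k ≤ n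
colour⇒2k≤n {n} {k} (1≤a , a≤m) = ℤ.drop‿+≤+ (ℤ.0≤i-j⇒j≤i
  -- Subtracting 1 from 1 ≤ a ≤ d + 1 gives 0 ≤ d.
  (subst (+ 0 ℤ.≤_) (trans (ℤ.+-assoc d 1ℤ (ℤ.- 1ℤ)) (ℤ.+-identityʳ d))
    (ℤ.+-monoˡ-≤ (ℤ.- 1ℤ) (ℤ.≤-trans (ℤ.+≤+ 1≤a) a≤m))))
  where
  d = + n - + (2 * k)

-- The maps on instances and solutions, and the reduction

module S = MonochromaticPair StableKSubset (λ n k → + ⌊ n /2⌋ - + (2 * k) + 1ℤ)
module K = MonochromaticPair KSubset (λ n k → + n - + (2 * k) + 1ℤ)

colour-padCircuit : ∀ {n} (C : Circuit n) A → colour (padCircuit C) A ≡ colour C (spread n A)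
colour-padCircuit C A = cong value (eval-padCircuit C A)

module _ (I : S.Instance) where
  open S.Instance I

  spread-colour : ∀ A → KSubset ⌊ n /2⌋ k A →
                  colour (padCircuit circuit) A ∈[ + ⌊ n /2⌋ - + (2 * k) + 1ℤ ]
  spread-colour A ∣A∣≡k = subst (_∈[ + ⌊ n /2⌋ - + (2 * k) + 1ℤ ]) (sym (colour-padCircuit circuit A))
    (colouring (spread n A) (spread-vertex n k A ∣A∣≡k))

  k≤⌊n/2⌋ : k ≤ ⌊ n /2⌋
  k≤⌊n/2⌋ = subst (_≤ ⌊ n /2⌋) (sym (n≡⌊n+n/2⌋ k))
    (⌊n/2⌋-mono (subst (λ m → k ℕ.+ m ≤ n) (+-identityʳ k) 2k≤n))

  2k≤⌊n/2⌋ : 2 * k ≤ ⌊ n /2⌋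
  2k≤⌊n/2⌋ with A , ∣A∣≡k ← exists-KSubset k≤⌊n/2⌋ = colour⇒2k≤n {k = k} (spread-colour A ∣A∣≡k)

  toKneser : K.Instance
  toKneser = record
    { n          = ⌊ n /2⌋
    ; k          = k
    ; n-positive = ≤-trans k-positive k≤⌊n/2⌋
    ; k-positive = k-positive
    ; 2k≤n       = 2k≤⌊n/2⌋
    ; circuit    = padCircuit circuit
    ; colouring  = spread-colour
    }

  fromKneser : K.Solution toKneser → S.Solution I
  fromKneser s = record
    { A          = spread n A
    ; B          = spread n B
    ; A-vertex   = spread-vertex n k A A-vertex
    ; B-vertex   = spread-vertex n k B B-vertex
    ; disjoint   = spread-empty n A B disjoint
    ; sameColour = trans (sym (colour-padCircuit circuit A)) (trans sameColour (colour-padCircuit circuit B))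
    }
    where open K.Solution s

theorem1p2 : PolyTimeReducible (Schrijver (λ n k → + ⌊ n /2⌋ - + (2 * k) + 1ℤ)) Kneser
theorem1p2 =
  toKneser , fromKneser ,
  (PadCircuit.machine , 15 , 2 , λ I → let open S.Instance I in
    PadCircuit.correct n k circuit) ,
  (SpreadSolution.machine , 3 , 1 , λ (I , s) → let open S.Instance I; open K.Solution s in
    SpreadSolution.correct n (encodeℕ k ++ encodeCircuit circuit) A B)
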